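{- The varieties $\mathbb{RDMP}$ (regular De Morgan p-algebras) and $\mathbb{RDMH}$ (regular De Morgan Heyting algebras) are term-equivalent to each other. More explicitly: (a) For $\mathbf A = \langle A, \lor, \land, {}^*, {}', 0, 1 \rangle \in \mathbb{RDMP}$, let $\mathbf{A}^{dmh} := \langle A, \lor, \land, \to, {}', 0, 1 \rangle$, where $x \to y := (x^{*} \lor y^{**})^{**} \land [(x \lor x^{*})'{}^{*}{}' \lor x^{*} \lor y \lor y^{*}]$. Then $\mathbf{A}^{dmh} \in \mathbb{RDMH}$. (b) For $\mathbf A = \langle A, \lor, \land, \to, {}', 0, 1 \rangle \in \mathbb{RDMH}$, let $\mathbf{A}^{dmp} := \langle A, \lor, \land, {}^*, {}', 0, 1 \rangle$, where $x^* := x \to 0$. Then $\mathbf{A}^{dmp} \in \mathbb{RDMP}$. (c) If $\mathbf A \in \mathbb{RDMP}$, then $(\mathbf{A}^{dmh})^{dmp} = \mathbf A$. (d) If $\mathbf A \in \mathbb{RDMH}$, then $(\mathbf{A}^{dmp})^{dmh} = \mathbf A$.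
   Context: A De Morgan algebra is a bounded distributive lattice with a unary operation ${}'$ satisfying $x''\approx x$, $(x\vee y)'\approx x'\wedge y'$, $(x\wedge y)'\approx x'\vee y'$, $0'\approx1$, $1'\approx0$. Write $x'{}^*{}'$ for $((x')^*)'$. $\mathbb{RDMP}$: algebras $\langle A,\vee,\wedge,{}^*,{}',0,1\rangle$ such that $\langle A,\vee,\wedge,{}',0,1\rangle$ is a De Morgan algebra, ${}^*$ is the pseudocomplement ($x^*$ is the largest $z$ with $x\wedge z=0$), and the regularity identity $(x\wedge x'{}^*{}')\vee(y\vee y^*)\approx y\vee y^*$ holds. $\mathbb{RDMH}$: algebras $\langle A,\vee,\wedge,\to,{}',0,1\rangle$ such that $\langle A,\vee,\wedge,{}',0,1\rangle$ is a De Morgan algebra, $\langle A,\vee,\wedge,\to,0,1\rangle$ is a Heyting algebra, and the same regularity identity holds with $x^*:=x\to0$. Term-equivalence here means precisely the content of (a)-(d). -}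

module Defs where

open import Level using (Level; _⊔_)
open import Algebra.Core using (Op₁; Op₂)
open import Data.Product.Base using (_×_)
open import Relation.Binary.Core using (Rel)
import Algebra.Definitions as Definitions
import Algebra.Lattice.Structures as AlgebraicLattice
import Relation.Binary.Lattice.Structures as OrderLattice
import Relation.Binary.Construct.NaturalOrder.Left as NaturalOrder

record DMPAlgebra {a : Level} (A : Set a) : Set a where
  infixl 8 _* _′
  infixr 7 _∧_
  infixr 6 _∨_
  field
    _∨_ : Op₂ A
    _∧_ : Op₂ A
    _*  : Op₁ A
    _′  : Op₁ A
    0#  : A
    1#  : A

record DMHAlgebra {a : Level} (A : Set a) : Set a where
  infixl 8 _′
  infixr 7 _∧_
  infixr 6 _∨_
  infixr 5 _⇨_
  field
    _∨_ : Op₂ A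
    _∧_ : Op₂ A
    _⇨_ : Op₂ A
    _′  : Op₁ A
    0#  : A
    1#  : A

infixl 9 _ᵈᵐʰ _ᵈᵐᵖ

_ᵈᵐʰ : {a : Level} {A : Set a} → DMPAlgebra A → DMHAlgebra A
𝐀 ᵈᵐʰ = record
  { _∨_ = _∨_
  ; _∧_ = _∧_
  ; _⇨_ = λ x y →
      (x * ∨ y * *) * * ∧ ((x ∨ x *) ′ * ′ ∨ x * ∨ y ∨ y *)
  ; _′  = _′
  ; 0#  = 0#
  ; 1#  = 1#
  }
  where open DMPAlgebra 𝐀

_ᵈᵐᵖ : {a : Level} {A : Set a} → DMHAlgebra A → DMPAlgebra A
𝐀 ᵈᵐᵖ = record
  { _∨_ = _∨_
  ; _∧_ = _∧_
  ; _*  = λ x → x ⇨ 0#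
  ; _′  = _′
  ; 0#  = 0#
  ; 1#  = 1#
  }
  where open DMHAlgebra 𝐀

-- The equality of an algebra is an arbitrary relation _≈_ on its carrier;
-- that it is an equivalence, and a congruence for _∨_ and _∧_, is part of
-- the library's IsDistributiveLattice.  Congruence of * and ⇨ follows from
-- their universal properties, so it is not required separately.

module _ {a ℓ : Level} {A : Set a} (_≈_ : Rel A ℓ) where

  open Definitions _≈_ using (Identity; Involutive; Congruent₁)

  record IsDeMorganAlgebra
    (_∨_ _∧_ : Op₂ A) (_′ : Op₁ A) (0# 1# : A) : Set (a ⊔ ℓ) where
    field
      isDistributiveLattice : AlgebraicLattice.IsDistributiveLattice _≈_ _∨_ _∧_
      ∨-identity            : Identity 0# _∨_
      ∧-identity            : Identity 1# _∧_
      ′-cong                : Congruent₁ _′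
      ′-involutive          : Involutive _′
      ′-∨                   : ∀ x y → ((x ∨ y) ′) ≈ ((x ′) ∧ (y ′))
      ′-∧                   : ∀ x y → ((x ∧ y) ′) ≈ ((x ′) ∨ (y ′))
      0′≈1                  : (0# ′) ≈ 1#
      1′≈0                  : (1# ′) ≈ 0#

  -- The library's left natural order: x ≤ y means x ≈ x ∧ y.
  LatticeOrder : Op₂ A → Rel A ℓ
  LatticeOrder _∧_ = NaturalOrder._≤_ _≈_ _∧_

  IsPseudocomplement : Op₂ A → Op₁ A → A → Set (a ⊔ ℓ)
  IsPseudocomplement _∧_ _* 0# =
    ∀ x → ((x ∧ (x *)) ≈ 0#) × (∀ z → (x ∧ z) ≈ 0# → z ≤ (x *))
    where
    _≤_ : Rel A ℓ
    _≤_ = LatticeOrder _∧_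

  Regular : DMPAlgebra A → Set (a ⊔ ℓ)
  Regular 𝐀 = ∀ x y → ((x ∧ x ′ * ′) ∨ (y ∨ y *)) ≈ (y ∨ y *)
    where open DMPAlgebra 𝐀

  record RDMP (𝐀 : DMPAlgebra A) : Set (a ⊔ ℓ) where
    open DMPAlgebra 𝐀
    field
      isDeMorganAlgebra  : IsDeMorganAlgebra _∨_ _∧_ _′ 0# 1#
      isPseudocomplement : IsPseudocomplement _∧_ _* 0#
      regular            : Regular 𝐀

  record RDMH (𝐀 : DMHAlgebra A) : Set (a ⊔ ℓ) where
    open DMHAlgebra 𝐀
    field
      isDeMorganAlgebra : IsDeMorganAlgebra _∨_ _∧_ _′ 0# 1#
      isHeytingAlgebra  :
        OrderLattice.IsHeytingAlgebra _≈_ (LatticeOrder _∧_) _∨_ _∧_ _⇨_ 1# 0#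
      -- the reduct 𝐀 ᵈᵐᵖ supplies x * = x ⇨ 0#
      regular           : Regular (𝐀 ᵈᵐᵖ)

  -- Equality of two algebras on the same carrier: every basic operation
  -- agrees pointwise.  With _≈_ taken to be _≡_ this is equality of algebras
  -- in the usual sense, stated without function extensionality.

  record DMPEqual (𝐀 𝐁 : DMPAlgebra A) : Set (a ⊔ ℓ) where
    private
      module 𝐀 = DMPAlgebra 𝐀
      module 𝐁 = DMPAlgebra 𝐁
    field
      ∨-equal : ∀ x y → (x 𝐀.∨ y) ≈ (x 𝐁.∨ y)
      ∧-equal : ∀ x y → (x 𝐀.∧ y) ≈ (x 𝐁.∧ y)
      *-equal : ∀ x → (x 𝐀.*) ≈ (x 𝐁.*)
      ′-equal : ∀ x → (x 𝐀.′) ≈ (x 𝐁.′)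
      0-equal : 𝐀.0# ≈ 𝐁.0#
      1-equal : 𝐀.1# ≈ 𝐁.1#

  record DMHEqual (𝐀 𝐁 : DMHAlgebra A) : Set (a ⊔ ℓ) where
    private
      module 𝐀 = DMHAlgebra 𝐀
      module 𝐁 = DMHAlgebra 𝐁
    field
      ∨-equal : ∀ x y → (x 𝐀.∨ y) ≈ (x 𝐁.∨ y)
      ∧-equal : ∀ x y → (x 𝐀.∧ y) ≈ (x 𝐁.∧ y)
      ⇨-equal : ∀ x y → (x 𝐀.⇨ y) ≈ (x 𝐁.⇨ y)
      ′-equal : ∀ x → (x 𝐀.′) ≈ (x 𝐁.′)
      0-equal : 𝐀.0# ≈ 𝐁.0#
      1-equal : 𝐀.1# ≈ 𝐁.1#

{-# OPTIONS --safe #-}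
-- Write x⁺ for x ′ * ′, which is a dual pseudocomplement: x ∨ x⁺ ≈ 1.  The
-- term x ⇨ y of 𝐀 ᵈᵐʰ is the residual of ∧.  If w ≤ x and w ≤ x ⇨ y, the first
-- factor of the term gives w ≤ y * *, and the second, by regularity applied to
-- x ∨ x *, gives w ≤ y ∨ y *; hence w ≤ y.  If z ∧ x ≤ y, then z is below the
-- second factor because (x ∨ x *)⁺ ∨ x ∨ x * ≈ 1.  Both round trips then follow
-- from the uniqueness of pseudocomplements and of residuals.
module Submission where

open import Defs
open import Level using (Level)
open import Algebra.Core using (Op₁; Op₂)
open import Algebra.Lattice.Bundles using (Lattice)
import Algebra.Lattice.Properties.Lattice as LatticeProperties
import Algebra.Lattice.Structures as AlgebraicLattice
open import Data.Product.Base using (_×_; _,_; proj₁; proj₂)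
open import Relation.Binary.Core using (Rel)
open import Relation.Binary.Lattice.Definitions using (Exponential)
import Relation.Binary.Lattice.Structures as OrderLattice

module DeMorganProperties
  {a ℓ : Level} {A : Set a} {_≈_ : Rel A ℓ}
  {_∨_ _∧_ : Op₂ A} {_′ : Op₁ A} {0# 1# : A}
  (isDeMorganAlgebra : IsDeMorganAlgebra _≈_ _∨_ _∧_ _′ 0# 1#)
  where

  open IsDeMorganAlgebra isDeMorganAlgebra public
  open AlgebraicLattice.IsDistributiveLattice isDistributiveLattice public
    using (sym; ∨-cong; ∧-cong; ∧-comm; ∧-distribˡ-∨)
    renaming (isLattice to isAlgebraicLattice; refl to ≈-refl; trans to ≈-trans)

  infix 4 _≤_
  _≤_ : Rel A ℓ
  _≤_ = LatticeOrder _≈_ _∧_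

  private
    algebraicLattice : Lattice a ℓ
    algebraicLattice = record { isLattice = isAlgebraicLattice }

  isBoundedLattice : OrderLattice.IsBoundedLattice _≈_ _≤_ _∨_ _∧_ 1# 0#
  isBoundedLattice = record
    { isLattice = ∨-∧-isOrderTheoreticLattice
    ; maximum   = λ x → sym (proj₂ ∧-identity x)
    ; minimum   = λ x →
        L.trans (L.x≤x∨y 0# x) (L.reflexive (proj₁ ∨-identity x))
    }
    where
    open LatticeProperties algebraicLattice using (∨-∧-isOrderTheoreticLattice)
    module L = OrderLattice.IsLattice ∨-∧-isOrderTheoreticLattice

  open OrderLattice.IsBoundedLattice isBoundedLattice public
    using ( refl; reflexive; trans; antisym; minimum; maximum
          ; x≤x∨y; y≤x∨y; ∨-least; x∧y≤x; x∧y≤y; ∧-greatest)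

  ∧-swap-≤ : ∀ {x y z} → (x ∧ y) ≤ z → (y ∧ x) ≤ z
  ∧-swap-≤ = trans (reflexive (∧-comm _ _))

  -- Distributivity packaged as a case split: `w` stays available in both branches, so it plays the
  -- part of a context.
  ∨-elim : ∀ {w x y z} → w ≤ (x ∨ y) → (w ∧ x) ≤ z → (w ∧ y) ≤ z → w ≤ z
  ∨-elim w≤x∨y w∧x≤z w∧y≤z = trans (∧-greatest refl w≤x∨y)
    (trans (reflexive (∧-distribˡ-∨ _ _ _)) (∨-least w∧x≤z w∧y≤z))

  ≤0⇒≈0 : ∀ {x} → x ≤ 0# → x ≈ 0#
  ≤0⇒≈0 x≤0 = antisym x≤0 (minimum _)

  pseudocomplement-unique : {_*₁ _*₂ : Op₁ A} →
    IsPseudocomplement _≈_ _∧_ _*₁ 0# → IsPseudocomplement _≈_ _∧_ _*₂ 0# →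
    ∀ x → (x *₁) ≈ (x *₂)
  pseudocomplement-unique p q x = antisym
    (proj₂ (q x) _ (proj₁ (p x)))
    (proj₂ (p x) _ (proj₁ (q x)))

  exponential-unique : {_⇨₁_ _⇨₂_ : Op₂ A} →
    Exponential _≤_ _∧_ _⇨₁_ → Exponential _≤_ _∧_ _⇨₂_ →
    ∀ x y → (x ⇨₁ y) ≈ (x ⇨₂ y)
  exponential-unique p q x y = antisym
    (proj₁ (q _ x y) (proj₂ (p _ x y) refl))
    (proj₁ (p _ x y) (proj₂ (q _ x y) refl))

  exponential⇒pseudocomplement : {_⇨_ : Op₂ A} →
    Exponential _≤_ _∧_ _⇨_ → IsPseudocomplement _≈_ _∧_ (λ x → x ⇨ 0#) 0#
  exponential⇒pseudocomplement e x =
    ≤0⇒≈0 (∧-swap-≤ (proj₂ (e _ x 0#) refl)) ,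
    λ z x∧z≈0 → proj₁ (e z x 0#) (∧-swap-≤ (reflexive x∧z≈0))

module RDMPProperties
  {a ℓ : Level} {A : Set a} {_≈_ : Rel A ℓ} {𝐀 : DMPAlgebra A}
  (rdmp : RDMP _≈_ 𝐀)
  where

  open DMPAlgebra 𝐀
  open DMHAlgebra (𝐀 ᵈᵐʰ) using (_⇨_)
  open RDMP rdmp
  open DeMorganProperties isDeMorganAlgebra public
    hiding (∨-identity; ∧-identity)

  *-greatest : ∀ {x z} → x ∧ z ≤ 0# → z ≤ x *
  *-greatest x∧z≤0 = proj₂ (isPseudocomplement _) _ (≤0⇒≈0 x∧z≤0)

  -- Ex falso for a common lower bound; it closes the impossible branches of `∨-elim`.
  *-contradiction : ∀ {w x z} → w ≤ x → w ≤ x * → w ≤ z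
  *-contradiction w≤x w≤x* = trans (∧-greatest w≤x w≤x*)
    (trans (reflexive (proj₁ (isPseudocomplement _))) (minimum _))

  x≤x** : ∀ {x} → x ≤ x * *
  x≤x** = *-greatest (*-contradiction (x∧y≤y _ _) (x∧y≤x _ _))

  regular-≤ : ∀ {x y} → x ∧ x ′ * ′ ≤ y ∨ y *
  regular-≤ = trans (x≤x∨y _ _) (reflexive (regular _ _))

  -- The De Morgan image of `x ′ ∧ x ′ * ≈ 0#`.
  1≤x∨x′*′ : ∀ {x} → 1# ≤ x ∨ x ′ * ′
  1≤x∨x′*′ {x} = reflexive (≈-trans (sym 0′≈1)
    (≈-trans (′-cong (sym (proj₁ (isPseudocomplement (x ′)))))
    (≈-trans (′-∧ _ _) (∨-cong (′-involutive x) ≈-refl))))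

  -- Split on `y ∨ y *`: the branch `y *` clashes with `y * *`.
  ≤y**⇒≤y∨y*⇒≤y : ∀ {w y} → w ≤ y * * → w ≤ y ∨ y * → w ≤ y
  ≤y**⇒≤y∨y*⇒≤y w≤y** w≤y∨y* = ∨-elim w≤y∨y* (x∧y≤y _ _)
    (*-contradiction (x∧y≤y _ _) (trans (x∧y≤x _ _) w≤y**))

  ⇨-apply : ∀ {w x y} → w ≤ x → w ≤ x ⇨ y → w ≤ y
  ⇨-apply {w} {x} {y} w≤x w≤x⇨y = ≤y**⇒≤y∨y*⇒≤y w≤y** w≤y∨y*
    where
    -- `x` excludes `x *` and `y *` excludes `y * *`, so the meet excludes their join.
    x∧y*≤[x*∨y**]* : x ∧ y * ≤ (x * ∨ y * *) *
    x∧y*≤[x*∨y**]* = *-greatest (∨-elim (x∧y≤x _ _)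
      (*-contradiction
        (trans (x∧y≤x _ _) (trans (x∧y≤y _ _) (x∧y≤x _ _))) (x∧y≤y _ _))
      (*-contradiction
        (trans (x∧y≤x _ _) (trans (x∧y≤y _ _) (x∧y≤y _ _))) (x∧y≤y _ _)))

    -- `y * ∧ w` lies below `(x * ∨ y * *) *` by the previous bound, and below its pseudocomplement,
    -- the first factor of `x ⇨ y`.
    w≤y** : w ≤ y * *
    w≤y** = *-greatest (*-contradiction
      (trans (∧-greatest (trans (x∧y≤y _ _) w≤x) (x∧y≤x _ _)) x∧y*≤[x*∨y**]*)
      (trans (x∧y≤y _ _) (trans w≤x⇨y (x∧y≤x _ _))))

    -- Cases on the second factor: regularity settles the first joinand, as `w ≤ x ≤ x ∨ x *`; `x *`
    -- contradicts `w ≤ x`; the rest is the goal.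
    w≤y∨y* : w ≤ y ∨ y *
    w≤y∨y* = ∨-elim (trans w≤x⇨y (x∧y≤y _ _))
      (trans (∧-greatest
        (trans (x∧y≤x _ _) (trans w≤x (x≤x∨y _ _))) (x∧y≤y _ _)) regular-≤)
      (∨-elim (x∧y≤y _ _)
        (*-contradiction
          (trans (x∧y≤x _ _) (trans (x∧y≤x _ _) w≤x)) (x∧y≤y _ _))
        (x∧y≤y _ _))

  ⇨-intro : ∀ {z x y} → z ∧ x ≤ y → z ≤ x ⇨ y
  ⇨-intro {z} {x} {y} z∧x≤y = ∧-greatest (*-greatest t∧z≤0) z≤second
    where
    -- The first factor is `t *`, so `z` lies below it once `t ∧ z` vanishes.
    t : A
    t = (x * ∨ y * *) *

    -- Under `x`, the element `z` gives `y`, hence `y * *`, which `t` excludes. The resulting `x *`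
    -- is excluded by `t` as well.
    t∧z≤x* : t ∧ z ≤ x *
    t∧z≤x* = *-greatest (*-contradiction
      (trans (∧-greatest (trans (x∧y≤y _ _) (x∧y≤y _ _)) (x∧y≤x _ _))
        (trans z∧x≤y (trans x≤x** (y≤x∨y _ _))))
      (trans (x∧y≤y _ _) (x∧y≤x _ _)))

    t∧z≤0 : t ∧ z ≤ 0#
    t∧z≤0 = *-contradiction (trans t∧z≤x* (x≤x∨y _ _)) (x∧y≤x _ _)

    -- In the case `x` the hypothesis supplies the joinand `y`; every other case is itself a
    -- joinand.
    z≤second : z ≤ (x ∨ x *) ′ * ′ ∨ x * ∨ y ∨ y *
    z≤second = ∨-elim (trans (maximum z) 1≤x∨x′*′)
      (∨-elim (x∧y≤y _ _)
        (trans (∧-greatest (trans (x∧y≤x _ _) (x∧y≤x _ _)) (x∧y≤y _ _))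
          (trans z∧x≤y (trans (x≤x∨y _ _) (trans (y≤x∨y _ _) (y≤x∨y _ _)))))
        (trans (x∧y≤y _ _) (trans (x≤x∨y _ _) (y≤x∨y _ _))))
      (trans (x∧y≤y _ _) (x≤x∨y _ _))

  ⇨-exponential : Exponential _≤_ _∧_ _⇨_
  ⇨-exponential w x y =
    ⇨-intro ,
    λ w≤x⇨y → ⇨-apply (x∧y≤y _ _) (trans (x∧y≤x _ _) w≤x⇨y)

  -- No computation with the term is needed: any residual into `0#` is a pseudocomplement.
  x⇨0≈x* : ∀ x → (x ⇨ 0#) ≈ (x *)
  x⇨0≈x* = pseudocomplement-unique
    (exponential⇒pseudocomplement ⇨-exponential) isPseudocomplement

  -- Here the star is the compound term `x ⇨ 0#`, equal to `x *` only up to `_≈_`, so regularity is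
  -- transported along that equality.
  ᵈᵐʰ-regular : Regular _≈_ (𝐀 ᵈᵐʰ ᵈᵐᵖ)
  ᵈᵐʰ-regular x y = ≈-trans
    (∨-cong (∧-cong ≈-refl (′-cong (x⇨0≈x* _))) y∨¬y≈y∨y*)
    (≈-trans (regular x y) (sym y∨¬y≈y∨y*))
    where
    y∨¬y≈y∨y* : (y ∨ (y ⇨ 0#)) ≈ (y ∨ y *)
    y∨¬y≈y∨y* = ∨-cong ≈-refl (x⇨0≈x* y)

module _ {a ℓ : Level} {A : Set a} {_≈_ : Rel A ℓ} where

  ᵈᵐʰ-isRDMH : {𝐀 : DMPAlgebra A} → RDMP _≈_ 𝐀 → RDMH _≈_ (𝐀 ᵈᵐʰ)
  ᵈᵐʰ-isRDMH rdmp = record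
    { isDeMorganAlgebra = RDMP.isDeMorganAlgebra rdmp
    ; isHeytingAlgebra  = record
      { isBoundedLattice = isBoundedLattice
      ; exponential      = ⇨-exponential
      }
    ; regular           = ᵈᵐʰ-regular
    }
    where open RDMPProperties rdmp

  ᵈᵐᵖ-isRDMP : {𝐀 : DMHAlgebra A} → RDMH _≈_ 𝐀 → RDMP _≈_ (𝐀 ᵈᵐᵖ)
  ᵈᵐᵖ-isRDMP rdmh = record
    { isDeMorganAlgebra  = isDeMorganAlgebra
    ; isPseudocomplement = exponential⇒pseudocomplement
        (OrderLattice.IsHeytingAlgebra.exponential isHeytingAlgebra)
    ; regular            = regular
    }
    where
    open RDMH rdmh
    open DeMorganProperties isDeMorganAlgebra
      using (exponential⇒pseudocomplement)

  ᵈᵐʰᵈᵐᵖ-equal : {𝐀 : DMPAlgebra A} → RDMP _≈_ 𝐀 →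
    DMPEqual _≈_ (𝐀 ᵈᵐʰ ᵈᵐᵖ) 𝐀
  ᵈᵐʰᵈᵐᵖ-equal rdmp = record
    { ∨-equal = λ _ _ → ≈-refl
    ; ∧-equal = λ _ _ → ≈-refl
    ; *-equal = x⇨0≈x*
    ; ′-equal = λ _ → ≈-refl
    ; 0-equal = ≈-refl
    ; 1-equal = ≈-refl
    }
    where open RDMPProperties rdmp

  -- Passing to `𝐀 ᵈᵐᵖ` keeps the meet and hence the order, so the term built there and the original
  -- `⇨` are residuals of the same meet.
  ᵈᵐᵖᵈᵐʰ-equal : {𝐀 : DMHAlgebra A} → RDMH _≈_ 𝐀 →
    DMHEqual _≈_ (𝐀 ᵈᵐᵖ ᵈᵐʰ) 𝐀
  ᵈᵐᵖᵈᵐʰ-equal rdmh = record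
    { ∨-equal = λ _ _ → ≈-refl
    ; ∧-equal = λ _ _ → ≈-refl
    ; ⇨-equal = exponential-unique ⇨-exponential
        (OrderLattice.IsHeytingAlgebra.exponential (RDMH.isHeytingAlgebra rdmh))
    ; ′-equal = λ _ → ≈-refl
    ; 0-equal = ≈-refl
    ; 1-equal = ≈-refl
    }
    where open RDMPProperties (ᵈᵐᵖ-isRDMP rdmh)

corollary2p8 : {a ℓ : Level} {A : Set a} (_≈_ : Rel A ℓ) →
    ((𝐀 : DMPAlgebra A) → RDMP _≈_ 𝐀 → RDMH _≈_ (𝐀 ᵈᵐʰ)) ×
    ((𝐀 : DMHAlgebra A) → RDMH _≈_ 𝐀 → RDMP _≈_ (𝐀 ᵈᵐᵖ)) ×
    ((𝐀 : DMPAlgebra A) → RDMP _≈_ 𝐀 → DMPEqual _≈_ (𝐀 ᵈᵐʰ ᵈᵐᵖ) 𝐀) ×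
    ((𝐀 : DMHAlgebra A) → RDMH _≈_ 𝐀 → DMHEqual _≈_ (𝐀 ᵈᵐᵖ ᵈᵐʰ) 𝐀)
corollary2p8 _≈_ =
  (λ _ → ᵈᵐʰ-isRDMH) , (λ _ → ᵈᵐᵖ-isRDMP) ,
  (λ _ → ᵈᵐʰᵈᵐᵖ-equal) , (λ _ → ᵈᵐᵖᵈᵐʰ-equal)
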